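{- For every integer $t\ge 2$ and every $\varepsilon>0$ the following holds for infinitely many $k$. There exist a vertex set $V$ containing a terminal set $K$ with $|K|=k$ and $k=o(|V|)$, and a family $\mathcal G$ of unweighted undirected graphs on vertex set $V$, each with $O(|V|)$ edges, such that any data structure (i.e., any encoding map $f$ from $\mathcal G$ to bit strings together with a decoding procedure that, given only $f(G)$, outputs for every pair $x,x'\in K$ an estimate $\delta(x,x')$) which satisfies either $d_G(x,x')\le \delta(x,x')\le (t-\varepsilon)\,d_G(x,x')$ for all $x,x'\in K$ and all $G\in\mathcal G$, or $d_G(x,x')\le \delta(x,x')\le d_G(x,x')+2t-3$ for all $x,x'\in K$ and all $G\in\mathcal G$, must use $\Omega(k^{1+1/(t-1)})$ bits on some $G\in\mathcal G$.
   Context: $d_G(x,x')$ denotes the shortest-path (hop) distance between $x$ and $x'$ in the unweighted graph $G$. -}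

module Defs where

open import Data.Bool.Base using (Bool)
open import Data.Fin.Base using (Fin; _<_)
open import Data.Fin.Properties using (_<?_)
open import Data.Fin.Subset using (Subset; ∣_∣; _∈_)
open import Data.List.Base using (List; length; filter; allFin; cartesianProduct)
import Data.Integer.Base as ℤ
open import Data.Maybe.Base as Maybe using ()
open import Data.Nat.Base as ℕ using (ℕ; zero; suc)
import Data.Nat.Properties as ℕ
open import Data.Product.Base using (_×_; _,_; ∃; ∃-syntax; proj₁; proj₂)
open import Data.Rational.Base as ℚ using (ℚ; 0ℚ; 1ℚ; ½)
import Data.Rational.Properties as ℚ
open import Data.Rational.Solver using (module +-*-Solver)
open import Level using (0ℓ)
open import Relation.Binary.Core using (Rel)
open import Relation.Binary.Definitions using (Decidable; Symmetric; Irreflexive)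
open import Relation.Binary.PropositionalEquality
  using (_≡_; refl; sym; cong; cong₂; subst; module ≡-Reasoning)
open import Relation.Nullary using (¬_)
open import Relation.Nullary.Decidable using (_×-dec_)
open import Relation.Nullary.Construct.Add.Supremum using (_⁺; ⊤⁺; [_])

-- Reals are Cauchy sequences of rationals with a modulus; order and arithmetic
-- act on the representatives.
record ℝ : Set where
  constructor mkℝ
  field
    seq    : ℕ → ℚ
    cauchy : ∀ η → 0ℚ ℚ.< η →
             ∃[ N ] (∀ m n → N ℕ.≤ m → N ℕ.≤ n → ℚ.∣ seq m ℚ.- seq n ∣ ℚ.≤ η)

open ℝ public

infix 4 _≤ᴿ_ _<ᴿ_

_≤ᴿ_ : Rel ℝ 0ℓ
x ≤ᴿ y = ∀ η → 0ℚ ℚ.< η → ∃[ N ] (∀ n → N ℕ.≤ n → seq x n ℚ.≤ seq y n ℚ.+ η)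

_<ᴿ_ : Rel ℝ 0ℓ
x <ᴿ y = ∃[ η ] (0ℚ ℚ.< η × ∃[ N ] (∀ n → N ℕ.≤ n → seq x n ℚ.+ η ℚ.≤ seq y n))

fromℚ : ℚ → ℝ
fromℚ q = mkℝ (λ _ → q) λ η 0<η → 0 , λ _ _ _ _ →
  subst (ℚ._≤ η) (sym (cong ℚ.∣_∣ (ℚ.+-inverseʳ q))) (ℚ.<⇒≤ 0<η)

fromℕ : ℕ → ℝ
fromℕ n = fromℚ (ℤ.+ n ℚ./ 1)

0ᴿ : ℝ
0ᴿ = fromℕ 0

infixl 6 _+ᴿ_ _-ᴿ_
infix  8 -ᴿ_
infixl 7 _·ᴿ_

private
  half-pos : ∀ η → 0ℚ ℚ.< η → 0ℚ ℚ.< ½ ℚ.* η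
  half-pos η 0<η = subst (ℚ._< ½ ℚ.* η) (ℚ.*-zeroʳ ½) (ℚ.*-monoʳ-<-pos ½ 0<η)

  half+half : ∀ η → ½ ℚ.* η ℚ.+ ½ ℚ.* η ≡ η
  half+half η = begin
    ½ ℚ.* η ℚ.+ ½ ℚ.* η ≡⟨ ℚ.*-distribʳ-+ η ½ ½ ⟨
    (½ ℚ.+ ½) ℚ.* η     ≡⟨ ℚ.*-identityˡ η ⟩
    η                   ∎
    where open ≡-Reasoning

  rearrange : ∀ a b c d → (a ℚ.+ b) ℚ.- (c ℚ.+ d) ≡ (a ℚ.- c) ℚ.+ (b ℚ.- d)
  rearrange = solve 4 (λ a b c d → (a :+ b) :- (c :+ d) := (a :- c) :+ (b :- d)) refl
    where open +-*-Solver

_+ᴿ_ : ℝ → ℝ → ℝ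
seq (x +ᴿ y) n = seq x n ℚ.+ seq y n
cauchy (x +ᴿ y) η 0<η
  with cauchy x (½ ℚ.* η) (half-pos η 0<η) | cauchy y (½ ℚ.* η) (half-pos η 0<η)
... | M , hx | N , hy = M ℕ.+ N , λ m n p q → begin
  ℚ.∣ (seq x m ℚ.+ seq y m) ℚ.- (seq x n ℚ.+ seq y n) ∣
    ≡⟨ cong ℚ.∣_∣ (rearrange (seq x m) (seq y m) (seq x n) (seq y n)) ⟩
  ℚ.∣ (seq x m ℚ.- seq x n) ℚ.+ (seq y m ℚ.- seq y n) ∣
    ≤⟨ ℚ.∣p+q∣≤∣p∣+∣q∣ (seq x m ℚ.- seq x n) (seq y m ℚ.- seq y n) ⟩
  ℚ.∣ seq x m ℚ.- seq x n ∣ ℚ.+ ℚ.∣ seq y m ℚ.- seq y n ∣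
    ≤⟨ ℚ.+-mono-≤ (hx m n (ℕ.m+n≤o⇒m≤o M p) (ℕ.m+n≤o⇒m≤o M q))
                  (hy m n (ℕ.m+n≤o⇒n≤o M p) (ℕ.m+n≤o⇒n≤o M q)) ⟩
  ½ ℚ.* η ℚ.+ ½ ℚ.* η
    ≡⟨ half+half η ⟩
  η ∎
  where open ℚ.≤-Reasoning

-ᴿ_ : ℝ → ℝ
seq (-ᴿ x) n = ℚ.- seq x n
cauchy (-ᴿ x) η 0<η with cauchy x η 0<η
... | N , h = N , λ m n p q → subst (ℚ._≤ η) (sym (lemma (seq x m) (seq x n))) (h m n p q)
  where
  open ≡-Reasoning
  lemma : ∀ a b → ℚ.∣ ℚ.- a ℚ.- ℚ.- b ∣ ≡ ℚ.∣ a ℚ.- b ∣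
  lemma a b = begin
    ℚ.∣ ℚ.- a ℚ.+ ℚ.- (ℚ.- b) ∣ ≡⟨ cong ℚ.∣_∣ (ℚ.neg-distrib-+ a (ℚ.- b)) ⟨
    ℚ.∣ ℚ.- (a ℚ.- b) ∣         ≡⟨ ℚ.∣-p∣≡∣p∣ (a ℚ.- b) ⟩
    ℚ.∣ a ℚ.- b ∣               ∎

_-ᴿ_ : ℝ → ℝ → ℝ
x -ᴿ y = x +ᴿ (-ᴿ y)

_·ᴿ_ : ℕ → ℝ → ℝ
zero  ·ᴿ x = 0ᴿ
suc n ·ᴿ x = x +ᴿ n ·ᴿ x

open import Relation.Binary.Construct.Add.Supremum.NonStrict _≤ᴿ_ public
  using (_≤⁺_)

record Graph (n : ℕ) : Set₁ where
  field
    Adj        : Rel (Fin n) 0ℓ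
    adj?       : Decidable Adj
    symmetric  : Symmetric Adj
    loopless   : Irreflexive _≡_ Adj

open Graph public

edgeCount : ∀ {n} → Graph n → ℕ
edgeCount {n} G =
  length (filter (λ e → (proj₁ e <? proj₂ e) ×-dec adj? G (proj₁ e) (proj₂ e))
                 (cartesianProduct (allFin n) (allFin n)))

data Walk {n} (G : Graph n) : Fin n → Fin n → ℕ → Set where
  here : ∀ {x} → Walk G x x 0
  step : ∀ {x y z l} → Adj G x y → Walk G y z l → Walk G x z (suc l)

-- IsDistance G x y d means d_G(x,y) = d.  The distance between vertices in
-- different components is the added top element.
IsDistance : ∀ {n} → Graph n → Fin n → Fin n → ℕ ⁺ → Set
IsDistance G x y [ d ] = Walk G x y d × (∀ l → Walk G x y l → d ℕ.≤ l)
IsDistance G x y ⊤⁺    = ∀ l → ¬ Walk G x y l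

record TerminalFamily (k : ℕ) : Set₁ where
  field
    order     : ℕ
    terminals : Subset order
    ∣K∣≡k     : ∣ terminals ∣ ≡ k
    size      : ℕ
    graph     : Fin size → Graph order

open TerminalFamily public

-- The decoder sees only the encoding and the queried pair.  Its values on
-- non-terminals are irrelevant.
record DataStructure {k} (F : TerminalFamily k) : Set where
  field
    encode : Fin (size F) → List Bool
    decode : List Bool → Fin (order F) → Fin (order F) → ℝ ⁺

  bits : Fin (size F) → ℕ
  bits j = length (encode j)

open DataStructure public

-- For d = ∞ the lower bound forces the estimate to be ∞ and the upper bound is
-- vacuous.
Estimates : ∀ {k} {F : TerminalFamily k} → DataStructure F → (ℕ → ℝ) → Set
Estimates {F = F} D upper =
  ∀ j x y → x ∈ terminals F → y ∈ terminals F →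
  ∀ d → IsDistance (graph F j) x y d →
    Maybe.map fromℕ d ≤⁺ decode D (encode D j) x y ×
    decode D (encode D j) x y ≤⁺ Maybe.map upper d

MultiplicativeError : ∀ {k} {F : TerminalFamily k} → DataStructure F → ℝ → Set
MultiplicativeError D α = Estimates D (λ d → d ·ᴿ α)

AdditiveError : ∀ {k} {F : TerminalFamily k} → DataStructure F → ℕ → Set
AdditiveError D β = Estimates D (λ d → fromℕ (d ℕ.+ β))

LittleO : (ℕ → ℕ) → (ℕ → ℕ) → Set
LittleO f g = ∀ M → ∃[ i₀ ] (∀ i → i₀ ℕ.≤ i → M ℕ.* f i ℕ.≤ g i)

-- L ≥ (1/b) k^(1 + 1/s) for s, b ≥ 1, with both sides multiplied by b and
-- raised to the power s.
AtLeastPower : (b s k L : ℕ) → Set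
AtLeastPower b s k L = k ℕ.^ suc s ℕ.≤ (b ℕ.* L) ℕ.^ s

{-# OPTIONS --safe #-}

-- A greedy (Erdős–Sachs) construction, joining two vertices of degree below Δ
-- as long as they are at distance above t − 1, yields a graph on
-- k = 2(Δ + 1)^(t − 1) vertices with kΔ/4 edges: while fewer edges are present
-- more than k/2 vertices have degree below Δ, and a ball of radius t − 1 has at
-- most k/2 vertices.  Deleting an edge of the result puts its ends at distance
-- at least t.
-- Subdivide every edge once, take the original vertices as terminals, and let
-- the family consist of all subgraphs in which some midpoints are isolated.  The
-- ends of an edge then have distance 2 if it is kept and at least 2t otherwise,
-- and both error bounds, applied to distance 2, stay below 2t.  Hence the
-- encoding is injective on a family indexed by the subsets of the edge set.
module Submission where

open import Defs
open import Data.Bool.Base using (Bool; true; false)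
open import Data.Empty using (⊥)
open import Data.Fin.Base as Fin
  using (Fin; zero; suc; _↑ˡ_; _↑ʳ_; splitAt; fromℕ<; finToFun; funToFin; combine)
open import Data.Fin.Properties as Fin
  using (injective⇒≤; splitAt-↑ˡ; splitAt-↑ʳ; splitAt⁻¹-↑ˡ; splitAt⁻¹-↑ʳ; funToFin-finToFin)
open import Data.Fin.Subset as Subset using (Subset)
open import Data.Fin.Subset.Properties using (∣⊥∣≡0)
import Data.Integer.Base as ℤ
import Data.Integer.Properties as ℤ
open import Data.List.Base
  using (List; []; _∷_; _++_; length; lookup; map; filter; concatMap; allFin; cartesianProduct)
open import Data.List.Membership.DecPropositional using (_∈?_)
open import Data.List.Membership.Propositional using (_∈_; lose; find)
open import Data.List.Membership.Propositional.Properties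
  using (∈-lookup; ∈-map⁺; ∈-filter⁺; ∈-filter⁻; ∈-concatMap⁺; ∈-allFin)
open import Data.List.Membership.Setoid.Properties using (index-injective)
open import Data.List.Properties using (length-++; length-map; length-tabulate; filter-reject)
open import Data.List.Relation.Unary.All as All using (All)
open import Data.List.Relation.Unary.AllPairs using ([]; _∷_)
open import Data.List.Relation.Unary.Any as Any using (here; there; any?)
open import Data.List.Relation.Unary.Unique.Propositional using (Unique)
open import Data.List.Relation.Unary.Unique.Propositional.Properties
  using (allFin⁺; filter⁺; cartesianProduct⁺)
open import Data.Maybe.Base as Maybe using ()
open import Data.Nat.Base as ℕ
  using (ℕ; zero; suc; _+_; _*_; _^_; _∸_; _≤_; _<_; z≤n; s≤s; z<s; s<s⁻¹)
open import Data.Nat.Induction using (<-rec)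
open import Data.Nat.Properties as ℕ
open import Data.Nat.Solver using () renaming (module +-*-Solver to ℕ-Solver)
open import Data.Product.Base using (_×_; _,_; proj₁; proj₂; ∃-syntax; Σ-syntax)
open import Data.Rational.Base as ℚ using (ℚ; 0ℚ; 1ℚ; ½)
open import Data.Rational.Literals using (fromℤ)
import Data.Rational.Properties as ℚ
open import Data.Rational.Solver using () renaming (module +-*-Solver to ℚ-Solver)
open import Data.Sum.Base as Sum using (_⊎_; inj₁; inj₂)
open import Data.Unit.Base using (⊤; tt)
import Data.Vec.Base as Vec
open import Function.Base using (_∘_; id; case_of_)
open import Function.Definitions using (Injective)
open import Level using (0ℓ)
open import Relation.Binary.Construct.Add.Supremum.NonStrict _≤ᴿ_ using ([_]; _≤⊤⁺)
open import Relation.Binary.Core using (Rel)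
open import Relation.Binary.Definitions using (DecidableEquality; Symmetric)
open import Relation.Binary.PropositionalEquality hiding ([_])
open import Relation.Nullary using (¬_; Dec; yes; no; contradiction)
open import Relation.Nullary.Construct.Add.Supremum using (_⁺; ⊤⁺; [_])
open import Relation.Nullary.Decidable using (¬?; decidable-stable; does; _×-dec_; _⊎-dec_)
open import Relation.Unary using (Pred; Decidable; _⊆_)

-- Counting in lists: pigeonhole and fibres.

private variable
  X Y : Set

Unique⇒lookup-injective : {xs : List X} → Unique xs →
                          ∀ i j → lookup xs i ≡ lookup xs j → i ≡ j
Unique⇒lookup-injective (_  ∷ _) zero    zero    _  = refl
Unique⇒lookup-injective (x≢ ∷ _) zero    (suc j) eq =
  contradiction eq (All.lookup x≢ (∈-lookup j))
Unique⇒lookup-injective (x≢ ∷ _) (suc i) zero    eq =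
  contradiction (sym eq) (All.lookup x≢ (∈-lookup i))
Unique⇒lookup-injective (_  ∷ u) (suc i) (suc j) eq =
  cong suc (Unique⇒lookup-injective u i j eq)

-- Sending a position in `xs` to the position of its element in `ys` is injective when `xs` has no
-- repetitions, so the pigeonhole principle on `Fin` applies.
Unique∧⊆⇒length≤ : {xs ys : List X} → Unique xs → (∀ {x} → x ∈ xs → x ∈ ys) →
                   length xs ≤ length ys
Unique∧⊆⇒length≤ u xs⊆ys =
  injective⇒≤ {f = λ i → Any.index (xs⊆ys (∈-lookup i))} λ {i} {j} eq →
    Unique⇒lookup-injective u i j
      (index-injective (setoid _) (xs⊆ys (∈-lookup i)) (xs⊆ys (∈-lookup j)) eq)

length-concatMap-≤ : (f : X → List Y) (c : ℕ) → (∀ x → length (f x) ≤ c) →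
                     ∀ xs → length (concatMap f xs) ≤ length xs * c
length-concatMap-≤ f c f≤c []       = z≤n
length-concatMap-≤ f c f≤c (x ∷ xs) = begin
  length (f x ++ concatMap f xs)         ≡⟨ length-++ (f x) ⟩
  length (f x) + length (concatMap f xs) ≤⟨ +-mono-≤ (f≤c x) (length-concatMap-≤ f c f≤c xs) ⟩
  c + length xs * c                      ∎
  where open ≤-Reasoning

module _ {P : Pred X 0ℓ} (P? : Decidable P) where

  length-filter-∁ : ∀ xs →
    length (filter P? xs) + length (filter (¬? ∘ P?) xs) ≡ length xs
  length-filter-∁ [] = refl
  length-filter-∁ (x ∷ xs) with does (P? x)
  ... | true  = cong suc (length-filter-∁ xs)
  ... | false = trans (+-suc _ _) (cong suc (length-filter-∁ xs))

  filter-filter-⊆ : {Q : Pred X 0ℓ} (Q? : Decidable Q) → P ⊆ Q →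
                    ∀ xs → filter P? (filter Q? xs) ≡ filter P? xs
  filter-filter-⊆ Q? P⊆Q [] = refl
  filter-filter-⊆ Q? P⊆Q (x ∷ xs) with Q? x
  ... | no ¬q = trans (filter-filter-⊆ Q? P⊆Q xs) (sym (filter-reject P? (¬q ∘ P⊆Q)))
  ... | yes _ with does (P? x)
  ...   | true  = cong (x ∷_) (filter-filter-⊆ Q? P⊆Q xs)
  ...   | false = filter-filter-⊆ Q? P⊆Q xs

module _ (_≟_ : DecidableEquality Y) (f : X → Y) where

  fibre : Y → List X → List X
  fibre y = filter (λ x → f x ≟ y)

  -- Fibres over distinct points are disjoint: deleting the fibre over `y` leaves the others intact.
  -- Applied to oriented edges, this bounds the number of vertices of large degree.
  fibres-≤ : ∀ c {ys} xs → Unique ys → (∀ {y} → y ∈ ys → c ≤ length (fibre y xs)) →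
             length ys * c ≤ length xs
  fibres-≤ c {[]}     xs u        large = z≤n
  fibres-≤ c {y ∷ ys} xs (y≢ ∷ u) large = begin
    c + length ys * c                  ≤⟨ +-mono-≤ (large (here refl)) (fibres-≤ c rest u large′) ⟩
    length (fibre y xs) + length rest  ≡⟨ length-filter-∁ (λ x → f x ≟ y) xs ⟩
    length xs                          ∎
    where
    open ≤-Reasoning
    rest = filter (λ x → ¬? (f x ≟ y)) xs
    large′ : ∀ {y′} → y′ ∈ ys → c ≤ length (fibre y′ rest)
    large′ {y′} y′∈ys = subst (λ zs → c ≤ length zs)
      (sym (filter-filter-⊆ (λ x → f x ≟ y′) (λ x → ¬? (f x ≟ y))
             (λ fx≡y′ fx≡y → All.lookup y≢ y′∈ys (trans (sym fx≡y) fx≡y′)) xs))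
      (large (there y′∈ys))

-- Walks of bounded length in a relation.

data Within {V : Set} (R : Rel V 0ℓ) (x : V) : V → ℕ → Set where
  here : ∀ {n} → Within R x x n
  step : ∀ {y z n} → R x z → Within R z y n → Within R x y (suc n)

module _ {V : Set} {R : Rel V 0ℓ} where

  within-mono-≤ : ∀ {x y m n} → m ≤ n → Within R x y m → Within R x y n
  within-mono-≤ m≤n       here       = here
  within-mono-≤ (s≤s m≤n) (step r w) = step r (within-mono-≤ m≤n w)

  within-0 : ∀ {x y} → Within R x y 0 → x ≡ y
  within-0 here = refl

  within-⊆ : {S : Rel V 0ℓ} → (∀ {x y} → R x y → S x y) →
             ∀ {x y n} → Within R x y n → Within S x y n
  within-⊆ R⊆S here       = here
  within-⊆ R⊆S (step r w) = step (R⊆S r) (within-⊆ R⊆S w)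

  -- The first walk is reversed step by step onto the front of the second, which acts as an
  -- accumulator. Reversal, in `within-sym`, is the case of a trivial second walk.
  within-meet : Symmetric R → ∀ {x p q m n} →
                Within R x p m → Within R x q n → Within R p q (m + n)
  within-meet sm {m = m}         here v = within-mono-≤ (m≤n+m _ m) v
  within-meet sm {m = suc m} {n} (step r w) v =
    subst (Within R _ _) (+-suc m n) (within-meet sm w (step (sm r) v))

  within-sym : Symmetric R → ∀ {x y n} → Within R x y n → Within R y x n
  within-sym sm w = subst (Within R _ _) (+-identityʳ _) (within-meet sm w (here {n = 0}))

  -- S is thought of as a single undirected edge.  A walk using it more than once
  -- is cut short between its first and last use; if these have opposite
  -- directions, S is not needed at all.
  within-∪ : {S : Rel V 0ℓ} →
             (∀ {p q p′ q′} → S p q → S p′ q′ → p ≡ p′ × q ≡ q′ ⊎ p ≡ q′ × q ≡ p′) →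
             ∀ {x y n} → Within (λ x y → R x y ⊎ S x y) x y n →
             Within R x y n ⊎
             (∃[ p ] ∃[ q ] ∃[ l ] ∃[ m ] Within R x p l × S p q × Within R q y m × l + suc m ≤ n)
  within-∪ one here = inj₁ here
  within-∪ one (step (inj₁ r) w) with within-∪ one w
  ... | inj₁ w′ = inj₁ (step r w′)
  ... | inj₂ (p , q , l , m , u , s , v , le) = inj₂ (p , q , suc l , m , step r u , s , v , s≤s le)
  within-∪ one (step (inj₂ s) w) with within-∪ one w
  ... | inj₁ w′ = inj₂ (_ , _ , 0 , _ , here , s , w′ , ≤-refl)
  ... | inj₂ (p , q , l , m , u , s′ , v , le) with one s s′
  ...   | inj₁ (refl , refl) = inj₂ (_ , _ , 0 , m , here , s , v , m≤n⇒m≤1+n (m+n≤o⇒n≤o l le))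
  ...   | inj₂ (refl , refl) = inj₁ (within-mono-≤
    (≤-trans (m+n≤o⇒n≤o (suc l) (≤-reflexive (sym (+-suc l m)))) (m≤n⇒m≤1+n le)) v)

-- Edge lists and girth.

module _ {k : ℕ} where

  Edges : Set
  Edges = List (Fin k × Fin k)

  Joins : Fin k × Fin k → Rel (Fin k) 0ℓ
  Joins (a , b) x y = x ≡ a × y ≡ b ⊎ x ≡ b × y ≡ a

  Joins-sym : ∀ e → Symmetric (Joins e)
  Joins-sym e = Sum.[ (λ (p , q) → inj₂ (q , p)) , (λ (p , q) → inj₁ (q , p)) ]

  Joins-unique : ∀ e {p q p′ q′} → Joins e p q → Joins e p′ q′ →
                 p ≡ p′ × q ≡ q′ ⊎ p ≡ q′ × q ≡ p′
  Joins-unique e (inj₁ (refl , refl)) (inj₁ (refl , refl)) = inj₁ (refl , refl)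
  Joins-unique e (inj₁ (refl , refl)) (inj₂ (refl , refl)) = inj₂ (refl , refl)
  Joins-unique e (inj₂ (refl , refl)) (inj₁ (refl , refl)) = inj₂ (refl , refl)
  Joins-unique e (inj₂ (refl , refl)) (inj₂ (refl , refl)) = inj₁ (refl , refl)

  -- Selecting edges by a predicate on positions keeps their numbering, so deleting one edge and
  -- passing to a subgraph are both instances.
  Linked : (E : Edges) → Pred (Fin (length E)) 0ℓ → Rel (Fin k) 0ℓ
  Linked E P x y = ∃[ i ] P i × Joins (lookup E i) x y

  Linked-sym : ∀ E P → Symmetric (Linked E P)
  Linked-sym E P (i , p , j) = i , p , Joins-sym (lookup E i) j

  -- No edge lies on a closed walk of length at most `s + 1` that uses it only once. Loops are
  -- excluded too, since `here` would join their ends, and so are parallel edges when `s` is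
  -- positive.
  HighGirth : ℕ → Edges → Set
  HighGirth s E = ∀ i →
    ¬ Within (Linked E (_≢ i)) (proj₁ (lookup E i)) (proj₂ (lookup E i)) s

  -- A short way around an old edge `i` must cross the new edge, say from `p` to `q`. Going back
  -- from `p` to one end of `i`, across `i`, and backwards along the rest to `q` then takes as many
  -- steps, all along old edges, which contradicts the distance between `a` and `b`.
  highGirth-∷ : ∀ {s E a b} → HighGirth s E → ¬ Within (Linked E (λ _ → ⊤)) a b s →
                HighGirth s ((a , b) ∷ E)
  highGirth-∷ {E = E} {a} {b} girth far zero w = far (within-⊆ old w)
    where
    old : ∀ {x y} → Linked ((a , b) ∷ E) (_≢ zero) x y → Linked E (λ _ → ⊤) x y
    old (zero  , 0≢0 , _) = contradiction refl 0≢0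
    old (suc i , _   , j) = i , tt , j
  highGirth-∷ {s} {E} {a} {b} girth far (suc i) w
    with within-∪ {R = Linked E (_≢ i)} {S = Joins (a , b)} (Joins-unique (a , b)) (within-⊆ classify w)
    where
    classify : ∀ {x y} → Linked ((a , b) ∷ E) (_≢ suc i) x y →
               Linked E (_≢ i) x y ⊎ Joins (a , b) x y
    classify (zero   , _ , j) = inj₂ j
    classify (suc i′ , ≢ , j) = inj₁ (i′ , ≢ ∘ cong suc , j)
  ... | inj₁ w′ = girth i w′
  ... | inj₂ (p , q , l , m , u , s′ , v , le) = far (orient s′ detour)
    where
    all : ∀ {x y} → Linked E (_≢ i) x y → Linked E (λ _ → ⊤) x y
    all (i′ , _ , j) = i′ , tt , j
    detour : Within (Linked E (λ _ → ⊤)) p q s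
    detour = within-mono-≤ le (within-meet (Linked-sym E (λ _ → ⊤)) (within-⊆ all u)
      (step (i , tt , inj₁ (refl , refl)) (within-sym (Linked-sym E (λ _ → ⊤)) (within-⊆ all v))))
    orient : Joins (a , b) p q → Within (Linked E (λ _ → ⊤)) p q s → Within (Linked E (λ _ → ⊤)) a b s
    orient (inj₁ (refl , refl)) w = w
    orient (inj₂ (refl , refl)) w = within-sym (Linked-sym E (λ _ → ⊤)) w

-- Degrees, balls and the greedy construction.

module _ {k : ℕ} where

  arcs : Fin k × Fin k → List (Fin k × Fin k)
  arcs (a , b) = (a , b) ∷ (b , a) ∷ []

  -- Each edge gives two arcs, and the arcs leaving `x` form a fibre of `proj₁`, so that `fibres-≤`
  -- serves as the handshake inequality.
  out : Edges → Fin k → List (Fin k × Fin k)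
  out E x = fibre Fin._≟_ proj₁ x (concatMap arcs E)

  degree : Edges → Fin k → ℕ
  degree E x = length (out E x)

  neighbours : Edges → Fin k → List (Fin k)
  neighbours E x = map proj₂ (out E x)

  Linked⇒neighbour : ∀ E {P x y} → Linked E P x y → y ∈ neighbours E x
  Linked⇒neighbour E {P} {x} {y} (i , _ , j) =
    ∈-map⁺ proj₂ (∈-filter⁺ (λ d → proj₁ d Fin.≟ x) {x = x , y}
      (∈-concatMap⁺ arcs {E} (lose {P = λ e → (x , y) ∈ arcs e} (∈-lookup i) (arc (lookup E i) j))) refl)
    where
    arc : ∀ e → Joins e x y → (x , y) ∈ arcs e
    arc e (inj₁ (refl , refl)) = here refl
    arc e (inj₂ (refl , refl)) = there (here refl)

  -- Repetitions are harmless, because only an upper bound on the length is wanted. Recursing from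
  -- `x` as well as from its neighbours covers the shorter walks and gives the factor `suc Δ`.
  ball : Edges → ℕ → Fin k → List (Fin k)
  ball E zero    x = x ∷ []
  ball E (suc n) x = concatMap (ball E n) (x ∷ neighbours E x)

  centre∈ball : ∀ E n x → x ∈ ball E n x
  centre∈ball E zero    x = here refl
  centre∈ball E (suc n) x = ∈-concatMap⁺ (ball E n) {x ∷ neighbours E x} (here (centre∈ball E n x))

  Within⇒∈ball : ∀ E {P x y n} → Within (Linked E P) x y n → y ∈ ball E n x
  Within⇒∈ball E {x = x} {n = n} here = centre∈ball E n x
  Within⇒∈ball E {x = x} (step {n = n} r w) =
    ∈-concatMap⁺ (ball E n) {x ∷ neighbours E x}
      (there (lose (Linked⇒neighbour E r) (Within⇒∈ball E w)))

  length-ball : ∀ E {Δ} → (∀ x → degree E x ≤ Δ) → ∀ n x → length (ball E n x) ≤ suc Δ ^ n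
  length-ball E     deg≤Δ zero    x = ≤-refl
  length-ball E {Δ} deg≤Δ (suc n) x = begin
    length (concatMap (ball E n) (x ∷ neighbours E x))
      ≤⟨ length-concatMap-≤ (ball E n) (suc Δ ^ n) (length-ball E deg≤Δ n) (x ∷ neighbours E x) ⟩
    suc (length (neighbours E x)) * suc Δ ^ n
      ≡⟨ cong (λ d → suc d * suc Δ ^ n) (length-map proj₂ (out E x)) ⟩
    suc (degree E x) * suc Δ ^ n
      ≤⟨ *-monoˡ-≤ (suc Δ ^ n) (s≤s (deg≤Δ x)) ⟩
    suc Δ ^ suc n ∎
    where open ≤-Reasoning

  degree-∷-≤ : ∀ {E Δ a b} → a ≢ b → degree E a < Δ → degree E b < Δ →
               (∀ x → degree E x ≤ Δ) → ∀ x → degree ((a , b) ∷ E) x ≤ Δ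
  degree-∷-≤ {a = a} {b} a≢b a<Δ b<Δ deg≤Δ x with a Fin.≟ x
  ... | yes refl with b Fin.≟ x
  ...   | yes refl = contradiction refl a≢b
  ...   | no _     = a<Δ
  degree-∷-≤ {a = a} {b} a≢b a<Δ b<Δ deg≤Δ x | no _ with b Fin.≟ x
  ...   | yes refl = b<Δ
  ...   | no _     = deg≤Δ x

  module Greedy (s Δ B : ℕ) (B+B≡k : B + B ≡ k) (ball≤B : suc Δ ^ s ≤ B) where

    low : Edges → List (Fin k)
    low E = filter (λ x → degree E x ℕ.<? Δ) (allFin k)

    high : Edges → List (Fin k)
    high E = filter (λ x → ¬? (degree E x ℕ.<? Δ)) (allFin k)

    ∈low⇒degree< : ∀ E {x} → x ∈ low E → degree E x < Δ
    ∈low⇒degree< E x∈low = proj₂ (∈-filter⁻ (λ x → degree E x ℕ.<? Δ) {xs = allFin k} x∈low)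

    ∈high⇒degree≥ : ∀ E {x} → x ∈ high E → Δ ≤ degree E x
    ∈high⇒degree≥ E x∈high =
      ≮⇒≥ (proj₂ (∈-filter⁻ (λ x → ¬? (degree E x ℕ.<? Δ)) {xs = allFin k} x∈high))

    -- Each vertex in `high E` is the start of at least `Δ` arcs, but there are fewer than `B * Δ`
    -- arcs in total; hence fewer than `B` of the `B + B` vertices are high.
    length-low : ∀ E → length E * 2 < B * Δ → B < length (low E)
    length-low E few = +-cancelʳ-< B B (length (low E)) (begin-strict
      B + B                            ≡⟨ B+B≡k ⟩
      k                                ≡⟨ length-tabulate {n = k} id ⟨
      length (allFin k)                ≡⟨ length-filter-∁ (λ x → degree E x ℕ.<? Δ) (allFin k) ⟨
      length (low E) + length (high E) <⟨ +-monoʳ-< (length (low E)) high<B ⟩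
      length (low E) + B               ∎)
      where
      open ≤-Reasoning
      high<B : length (high E) < B
      high<B = *-cancelʳ-< Δ (length (high E)) B (begin-strict
        length (high E) * Δ         ≤⟨ fibres-≤ Fin._≟_ proj₁ Δ (concatMap arcs E)
                                         (filter⁺ (λ x → ¬? (degree E x ℕ.<? Δ)) (allFin⁺ k))
                                         (∈high⇒degree≥ E) ⟩
        length (concatMap arcs E)   ≤⟨ length-concatMap-≤ arcs 2 (λ _ → ≤-refl) E ⟩
        length E * 2                <⟨ few ⟩
        B * Δ                       ∎)

    Good : Edges → Set
    Good E = (∀ x → degree E x ≤ Δ) × HighGirth s E

    -- Any low vertex serves as `a`. The low vertices outnumber the ball around `a`, so some low `b`
    -- lies outside it; `b` differs from `a` because the ball contains its centre.
    extend : ∀ E → Good E → length E * 2 < B * Δ → ∃[ e ] Good (e ∷ E)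
    extend E (deg≤Δ , girth) few
      with low E in eq | length-low E few
    ... | a ∷ as | B<low with any? (λ b → ¬? (_∈?_ Fin._≟_ b (ball E s a))) (a ∷ as)
    ...   | no ¬any = contradiction B<low (≤⇒≯ (begin
              length (a ∷ as)      ≤⟨ Unique∧⊆⇒length≤ unique inBall ⟩
              length (ball E s a)  ≤⟨ length-ball E deg≤Δ s a ⟩
              suc Δ ^ s            ≤⟨ ball≤B ⟩
              B                    ∎))
      where
      open ≤-Reasoning
      unique : Unique (a ∷ as)
      unique = subst Unique eq (filter⁺ (λ x → degree E x ℕ.<? Δ) (allFin⁺ k))
      inBall : ∀ {b} → b ∈ a ∷ as → b ∈ ball E s a
      inBall b∈ = decidable-stable (_∈?_ Fin._≟_ _ _) λ b∉ → ¬any (lose b∈ b∉)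
    ...   | yes any with find any
    ...     | b , b∈low , b∉ball = (a , b) ,
      degree-∷-≤ {E = E} a≢b (∈low⇒degree< E (subst (a ∈_) (sym eq) (here refl)))
                     (∈low⇒degree< E (subst (b ∈_) (sym eq) b∈low)) deg≤Δ ,
      highGirth-∷ girth (b∉ball ∘ Within⇒∈ball E)
      where
      a≢b : a ≢ b
      a≢b refl = b∉ball (centre∈ball E s a)

    greedy : ∀ n → n * 2 ≤ B * Δ → ∃[ E ] length E ≡ n × Good E
    greedy zero    _  = [] , refl , (λ _ → z≤n) , λ ()
    greedy (suc n) le with greedy n (≤-trans (*-monoˡ-≤ 2 (n≤1+n n)) le)
    -- The bound for `suc n` exceeds `n * 2` by two, which leaves room for the strict inequality
    -- required by `extend`.
    ... | E , refl , good with extend E good (≤-trans (n≤1+n _) le)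
    ...   | e , good′ = e ∷ E , refl , good′

-- Counting bit strings.

-- Bijective base 2, so that leading zeros are not lost.
code : List Bool → ℕ
code []           = 0
code (false ∷ bs) = 1 + 2 * code bs
code (true  ∷ bs) = 2 + 2 * code bs

code-injective : Injective _≡_ _≡_ code
code-injective {[]}         {[]}         _  = refl
code-injective {[]}         {false ∷ _}  ()
code-injective {[]}         {true ∷ _}   ()
code-injective {false ∷ _}  {[]}         ()
code-injective {true ∷ _}   {[]}         ()
code-injective {false ∷ as} {false ∷ bs} eq =
  cong (false ∷_) (code-injective (*-cancelˡ-≡ _ _ 2 (suc-injective eq)))
code-injective {true ∷ as}  {true ∷ bs}  eq =
  cong (true ∷_) (code-injective (*-cancelˡ-≡ _ _ 2 (suc-injective (suc-injective eq))))
code-injective {false ∷ as} {true ∷ bs}  eq =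
  contradiction (suc-injective eq) (even≢odd (code as) (code bs))
code-injective {true ∷ as}  {false ∷ bs} eq =
  contradiction (sym (suc-injective eq)) (even≢odd (code bs) (code as))

-- Strings shorter than `m` get codes below `2 ^ m ∸ 1`. The summand 2 makes the induction a plain
-- doubling, exact for a leading `true`.
code-bound : ∀ bs → 2 + code bs ≤ 2 ^ suc (length bs)
code-bound []       = ≤-refl
code-bound (b ∷ bs) = ≤-trans (bit b) (*-monoʳ-≤ 2 (code-bound bs))
  where
  eq : 2 * (2 + code bs) ≡ 4 + 2 * code bs
  eq = *-distribˡ-+ 2 2 (code bs)
  bit : ∀ b → 2 + code (b ∷ bs) ≤ 2 * (2 + code bs)
  bit true  = ≤-reflexive (sym eq)
  bit false = ≤-trans (n≤1+n _) (≤-reflexive (sym eq))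

-- If every encoding were shorter than `m`, the codes would inject `Fin n` into `Fin (2 ^ m ∸ 1)`.
injective⇒long : ∀ {n} m (enc : Fin n → List Bool) → Injective _≡_ _≡_ enc → 2 ^ m ≤ n →
                 ∃[ j ] m ≤ length (enc j)
injective⇒long {n} m enc inj 2^m≤n with Fin.any? (λ j → m ≤? length (enc j))
... | yes long  = long
... | no ¬long = contradiction
  (≤-trans 2^m≤n (injective⇒≤ {f = index} λ {i} {j} eq →
    inj (code-injective (Fin.fromℕ<-injective _ _ (bound i) (bound j) eq))))
  (<⇒≱ (∸-monoʳ-< {o = 0} z<s (m^n>0 2 m)))
  where
  bound : ∀ j → code (enc j) < 2 ^ m ∸ 1
  bound j = ∸-monoˡ-≤ 1 (≤-trans (code-bound (enc j))
    (^-monoʳ-≤ 2 (≰⇒> (λ m≤ → ¬long (j , m≤)))))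
  index : Fin n → Fin (2 ^ m ∸ 1)
  index j = fromℕ< (bound j)

-- Inequalities between rationals and reals.

[_]ℚ : ℕ → ℚ
[ n ]ℚ = ℤ.+ n ℚ./ 1

-- The quotient `n / 1` is normalised by a gcd and is stuck on a variable; `fromℤ` is in constructor
-- form, so rewriting with this lets sums and comparisons compute.
[]ℚ-fromℤ : ∀ n → [ n ]ℚ ≡ fromℤ (ℤ.+ n)
[]ℚ-fromℤ n = ℚ.↥p/↧p≡p (fromℤ (ℤ.+ n))

[]ℚ-+ : ∀ m n → [ m ]ℚ ℚ.+ [ n ]ℚ ≡ [ m + n ]ℚ
[]ℚ-+ m n rewrite []ℚ-fromℤ m | []ℚ-fromℤ n = cong (ℚ._/ 1)
  (cong₂ ℤ._+_ (ℤ.*-identityʳ (ℤ.+ m)) (ℤ.*-identityʳ (ℤ.+ n)))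

[]ℚ-mono-≤ : ∀ {m n} → m ≤ n → [ m ]ℚ ℚ.≤ [ n ]ℚ
[]ℚ-mono-≤ {m} {n} m≤n rewrite []ℚ-fromℤ m | []ℚ-fromℤ n =
  ℚ.*≤* (ℤ.*-monoʳ-≤-nonNeg (ℤ.+ 1) (ℤ.+≤+ m≤n))

fromℕ-mono-< : ∀ {m n} → m < n → fromℕ m <ᴿ fromℕ n
fromℕ-mono-< {m} {n} m<n = 1ℚ , ℚ.*<* (ℤ.+<+ (ℕ.s≤s ℕ.z≤n)) , 0 , λ _ _ →
  subst (ℚ._≤ [ n ]ℚ) (trans (cong [_]ℚ (ℕ.+-comm 1 m)) (sym ([]ℚ-+ m 1))) ([]ℚ-mono-≤ m<n)

quarter : ℚ → ℚ
quarter p = ½ ℚ.* (½ ℚ.* p)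

quarter-pos : ∀ {p} → 0ℚ ℚ.< p → 0ℚ ℚ.< quarter p
quarter-pos = half-pos ∘ half-pos
  where
  half-pos : ∀ {p} → 0ℚ ℚ.< p → 0ℚ ℚ.< ½ ℚ.* p
  half-pos {p} 0<p = subst (ℚ._< ½ ℚ.* p) (ℚ.*-zeroʳ ½) (ℚ.*-monoʳ-<-pos ½ 0<p)

≤ᴿ∧≤ᴿ⇒≮ᴿ : ∀ {x r y} → x ≤ᴿ r → r ≤ᴿ y → ¬ y <ᴿ x
≤ᴿ∧≤ᴿ⇒≮ᴿ {x} {r} {y} x≤r r≤y (η , 0<η , N , y<x)
  -- Two slacks of a quarter use up half of `η`; the other half makes the contradiction strict.
  with x≤r (quarter η) (quarter-pos 0<η) | r≤y (quarter η) (quarter-pos 0<η)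
... | L , x≤r+q | M , r≤y+q = ℚ.<-irrefl refl (begin-strict
  yₙ ℚ.+ η                       ≤⟨ y<x n (m≤m+n N (L + M)) ⟩
  seq x n                        ≤⟨ x≤r+q n (≤-trans (m≤m+n L M) (m≤n+m (L + M) N)) ⟩
  seq r n ℚ.+ q                  ≤⟨ ℚ.+-monoˡ-≤ q (r≤y+q n (≤-trans (m≤n+m M L) (m≤n+m (L + M) N))) ⟩
  yₙ ℚ.+ q ℚ.+ q                 ≡⟨ ℚ.+-identityʳ _ ⟨
  yₙ ℚ.+ q ℚ.+ q ℚ.+ 0ℚ          <⟨ ℚ.+-monoʳ-< (yₙ ℚ.+ q ℚ.+ q)
                                      (ℚ.+-mono-< (quarter-pos 0<η) (quarter-pos 0<η)) ⟩
  yₙ ℚ.+ q ℚ.+ q ℚ.+ (q ℚ.+ q)   ≡⟨ quarters yₙ η ⟩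
  yₙ ℚ.+ η                       ∎)
  where
  open ℚ.≤-Reasoning
  n = N + (L + M)
  yₙ = seq y n
  q = quarter η
  quarters : ∀ y η → let q = quarter η in y ℚ.+ q ℚ.+ q ℚ.+ (q ℚ.+ q) ≡ y ℚ.+ η
  quarters = solve 2 (λ y η → let q = con ½ :* (con ½ :* η) in
    y :+ q :+ q :+ (q :+ q) := y :+ η) refl
    where open ℚ-Solver

-- Doubling subtracts `ε` twice from `2t`. One copy pays for the gap `η`, and the other is
-- nonnegative. The summand `0ℚ` in `S` comes from unfolding `2 ·ᴿ_`.
2·[t-ε]<2t : ∀ {t ε d} → 0ᴿ <ᴿ ε → t * 2 ≤ d → 2 ·ᴿ (fromℕ t -ᴿ ε) <ᴿ fromℕ d
2·[t-ε]<2t {t} {ε} {d} (η , 0<η , N , η≤ε) 2t≤d = η , 0<η , N , λ n N≤n →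
  let T = [ t ]ℚ
      e = seq ε n
      S = (T ℚ.- e) ℚ.+ ((T ℚ.- e) ℚ.+ 0ℚ)
      η≤e : η ℚ.≤ e
      η≤e = subst (ℚ._≤ e) (ℚ.+-identityˡ η) (η≤ε n N≤n)
  in begin
  S ℚ.+ η         ≤⟨ ℚ.+-monoʳ-≤ S η≤e ⟩
  S ℚ.+ e         ≡⟨ ℚ.+-identityʳ (S ℚ.+ e) ⟨
  S ℚ.+ e ℚ.+ 0ℚ  ≤⟨ ℚ.+-monoʳ-≤ (S ℚ.+ e) (ℚ.≤-trans (ℚ.<⇒≤ 0<η) η≤e) ⟩
  S ℚ.+ e ℚ.+ e   ≡⟨ cancel T e ⟩
  T ℚ.+ T         ≡⟨ []ℚ-+ t t ⟩
  [ t + t ]ℚ      ≤⟨ []ℚ-mono-≤ (subst (_≤ d) 2t 2t≤d) ⟩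
  [ d ]ℚ          ∎
  where
  open ℚ.≤-Reasoning
  2t : t * 2 ≡ t + t
  2t = trans (ℕ.*-comm t 2) (cong (t +_) (ℕ.+-identityʳ t))
  cancel : ∀ T e → (T ℚ.- e) ℚ.+ ((T ℚ.- e) ℚ.+ 0ℚ) ℚ.+ e ℚ.+ e ≡ T ℚ.+ T
  cancel = solve 2 (λ T e → (T :- e) :+ ((T :- e) :+ con 0ℚ) :+ e :+ e := T :+ T) refl
    where open ℚ-Solver

-- Distances, terminal sets and subsets coded as numbers.

-- If no finite distance exists, strong induction on the length excludes every walk, and then the
-- distance is infinite. The double negation is enough, since it is applied only to reach a
-- contradiction.
¬¬-distance : ∀ {n} (G : Graph n) x y → ¬ (∀ d → ¬ IsDistance G x y d)
¬¬-distance G x y none = none ⊤⁺ (<-rec (λ l → ¬ Walk G x y l) λ l shorter w →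
  none [ l ] (w , λ l′ w′ → ≮⇒≥ λ l′<l → shorter l′<l w′))

prefix : ∀ k m → Subset (k + m)
prefix k m = Subset.⊤ {k} Vec.++ Subset.⊥ {m}

∣prefix∣ : ∀ k m → Subset.∣ prefix k m ∣ ≡ k
∣prefix∣ zero    m = ∣⊥∣≡0 m
∣prefix∣ (suc k) m = cong suc (∣prefix∣ k m)

↑ˡ∈prefix : ∀ {k} m (x : Fin k) → x ↑ˡ m Subset.∈ prefix k m
↑ˡ∈prefix m zero    = Vec.here
↑ˡ∈prefix m (suc x) = Vec.there (↑ˡ∈prefix m x)

finToFun-injective : ∀ {m} n {i j : Fin (m ^ n)} →
                     (∀ x → finToFun {m} {n} i x ≡ finToFun {m} {n} j x) → i ≡ j
finToFun-injective {m} n {i} {j} eq = begin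
  i                              ≡⟨ funToFin-finToFin {n} {m} i ⟨
  funToFin (finToFun {m} {n} i)  ≡⟨ funToFin-cong n eq ⟩
  funToFin (finToFun {m} {n} j)  ≡⟨ funToFin-finToFin {n} {m} j ⟩
  j                              ∎
  where
  open ≡-Reasoning
  funToFin-cong : ∀ n {f g : Fin n → Fin m} → (∀ x → f x ≡ g x) → funToFin f ≡ funToFin g
  funToFin-cong zero    eq = refl
  funToFin-cong (suc n) eq = cong₂ combine (eq zero) (funToFin-cong n (eq ∘ suc))

-- The subdivided graph and its subgraphs.

module Subdivision {k : ℕ} (E : Edges {k}) where

  m : ℕ
  m = length E

  source target : Fin m → Fin k
  source e = proj₁ (lookup E e)
  target e = proj₂ (lookup E e)

  Incident : Fin m → Fin k → Set
  Incident e x = x ≡ source e ⊎ x ≡ target e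

  incident? : ∀ e x → Dec (Incident e x)
  incident? e x = (x Fin.≟ source e) ⊎-dec (x Fin.≟ target e)

  -- Vertices of the graph and midpoints of its edges.
  Node : Set
  Node = Fin k ⊎ Fin m

  module _ {P : Pred (Fin m) 0ℓ} (P? : Decidable P) where

    Half : Rel Node 0ℓ
    Half (inj₁ _) (inj₁ _) = ⊥
    Half (inj₁ x) (inj₂ e) = P e × Incident e x
    Half (inj₂ e) (inj₁ x) = P e × Incident e x
    Half (inj₂ _) (inj₂ _) = ⊥

    half? : ∀ p q → Dec (Half p q)
    half? (inj₁ _) (inj₁ _) = no λ ()
    half? (inj₁ x) (inj₂ e) = P? e ×-dec incident? e x
    half? (inj₂ e) (inj₁ x) = P? e ×-dec incident? e x
    half? (inj₂ _) (inj₂ _) = no λ ()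

    half-sym : Symmetric Half
    half-sym {inj₁ _} {inj₂ _} h = h
    half-sym {inj₂ _} {inj₁ _} h = h

    half-irrefl : ∀ p → ¬ Half p p
    half-irrefl (inj₁ _) ()
    half-irrefl (inj₂ _) ()

    subdivide : Graph (k + m)
    Adj       subdivide p q = Half (splitAt k p) (splitAt k q)
    adj?      subdivide p q = half? (splitAt k p) (splitAt k q)
    symmetric subdivide     = half-sym
    loopless  subdivide {p} refl = half-irrefl (splitAt k p)

    halves : Fin m → List (Fin (k + m) × Fin (k + m))
    halves e = (source e ↑ˡ m , k ↑ʳ e) ∷ (target e ↑ˡ m , k ↑ʳ e) ∷
               (k ↑ʳ e , source e ↑ˡ m) ∷ (k ↑ʳ e , target e ↑ˡ m) ∷ []

    Adj⇒halves : ∀ p q → Adj subdivide p q → ∃[ e ] (p , q) ∈ halves e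
    Adj⇒halves p q h with splitAt k p in p≡ | splitAt k q in q≡ | h
    ... | inj₁ x | inj₂ e | _ , inc with splitAt⁻¹-↑ˡ p≡ | splitAt⁻¹-↑ʳ q≡ | inc
    ...   | refl | refl | inj₁ refl = e , here refl
    ...   | refl | refl | inj₂ refl = e , there (here refl)
    Adj⇒halves p q h | inj₂ e | inj₁ x | _ , inc
      with splitAt⁻¹-↑ʳ p≡ | splitAt⁻¹-↑ˡ q≡ | inc
    ...   | refl | refl | inj₁ refl = e , there (there (here refl))
    ...   | refl | refl | inj₂ refl = e , there (there (there (here refl)))

    -- The counted pairs are distinct, and each is one of the four oriented halves of some edge,
    -- whatever `P` selects.
    edgeCount-subdivide : edgeCount subdivide ≤ 4 * (k + m)
    edgeCount-subdivide = begin
      edgeCount subdivide                  ≤⟨ Unique∧⊆⇒length≤ unique covered ⟩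
      length (concatMap halves (allFin m)) ≤⟨ length-concatMap-≤ halves 4 (λ _ → ≤-refl) (allFin m) ⟩
      length (allFin m) * 4                ≡⟨ cong (_* 4) (length-tabulate {n = m} id) ⟩
      m * 4                                ≡⟨ *-comm m 4 ⟩
      4 * m                                ≤⟨ *-monoʳ-≤ 4 (m≤n+m m k) ⟩
      4 * (k + m)                          ∎
      where
      open ≤-Reasoning
      pairs : List (Fin (k + m) × Fin (k + m))
      pairs = cartesianProduct (allFin (k + m)) (allFin (k + m))
      edge? : Decidable (λ (p , q) → p Fin.< q × Adj subdivide p q)
      edge? (p , q) = (p Fin.<? q) ×-dec adj? subdivide p q
      unique : Unique (filter edge? pairs)
      unique = filter⁺ edge? (cartesianProduct⁺ (allFin⁺ (k + m)) (allFin⁺ (k + m)))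
      covered : ∀ {e} → e ∈ filter edge? pairs → e ∈ concatMap halves (allFin m)
      covered {p , q} e∈
        with Adj⇒halves p q (proj₂ (proj₂ (∈-filter⁻ edge? {xs = pairs} e∈)))
      ... | e , e∈halves = ∈-concatMap⁺ halves {allFin m} (lose (∈-allFin e) e∈halves)

    -- Vertices and midpoints alternate along a walk, so each pair of steps either crosses an edge
    -- satisfying `P` or returns to where it started. A length of at most `2n + 1` therefore gives
    -- at most `n` edges.
    contract : ∀ n {p q l x y} → Walk subdivide p q l → l < suc n * 2 →
               splitAt k p ≡ inj₁ x → splitAt k q ≡ inj₁ y →
               Within (Linked E P) x y n
    contract n here _ p≡ q≡ with trans (sym p≡) q≡
    ... | refl = here
    contract n {p} (step {y = r} h w) l< p≡ q≡ with splitAt k p | splitAt k r in r≡ | h | p≡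
    ... | inj₁ x | inj₂ e | Pe , x∈e | refl with w
    -- A single step would end at a midpoint, but the final node is a vertex.
    ...   | here with () ← trans (sym r≡) q≡
    ...   | step {y = r′} {l = l} h′ w′ with splitAt k r | splitAt k r′ in r′≡ | h′ | r≡
    ...     | inj₂ e | inj₁ z | _ , z∈e | refl = through n (s<s⁻¹ (s<s⁻¹ l<)) x∈e z∈e
      where
      through : ∀ n → l < n * 2 → Incident e x → Incident e z → Within (Linked E P) x _ n
      -- In the first two cases the walk backtracks and no edge is crossed; in the other two it
      -- crosses `e` in one direction or the other.
      through (suc n) l< (inj₁ refl) (inj₁ refl) = within-mono-≤ (n≤1+n n) (contract n w′ l< r′≡ q≡)
      through (suc n) l< (inj₂ refl) (inj₂ refl) = within-mono-≤ (n≤1+n n) (contract n w′ l< r′≡ q≡)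
      through (suc n) l< (inj₁ x≡)   (inj₂ z≡)   = step (e , Pe , inj₁ (x≡ , z≡)) (contract n w′ l< r′≡ q≡)
      through (suc n) l< (inj₂ x≡)   (inj₁ z≡)   = step (e , Pe , inj₂ (x≡ , z≡)) (contract n w′ l< r′≡ q≡)

  module _ {s : ℕ} (girth : HighGirth s E) where

    source≢target : ∀ e → source e ≢ target e
    source≢target e eq = girth e (subst (λ v → Within (Linked E (_≢ e)) (source e) v s) eq here)

    distance-kept : ∀ {P} (P? : Decidable P) {e} → P e →
                    IsDistance (subdivide P?) (source e ↑ˡ m) (target e ↑ˡ m) [ 2 ]
    distance-kept P? {e} Pe = walk , shortest
      where
      walk : Walk (subdivide P?) (source e ↑ˡ m) (target e ↑ˡ m) 2
      walk = step {y = k ↑ʳ e}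
        (subst₂ (Half P?) (sym (splitAt-↑ˡ k (source e) m)) (sym (splitAt-↑ʳ k m e)) (Pe , inj₁ refl))
        (step (subst₂ (Half P?) (sym (splitAt-↑ʳ k m e)) (sym (splitAt-↑ˡ k (target e) m)) (Pe , inj₂ refl)) here)
      shortest : ∀ l → Walk (subdivide P?) (source e ↑ˡ m) (target e ↑ˡ m) l → 2 ≤ l
      shortest l w = ≮⇒≥ λ l<2 → source≢target e (within-0
        (contract P? 0 w l<2 (splitAt-↑ˡ k (source e) m) (splitAt-↑ˡ k (target e) m)))

    -- A shorter walk would contract to at most `s` edges, all satisfying `P` and hence different
    -- from `e`, so it would be a forbidden detour around `e`.
    distance-removed : ∀ {P} (P? : Decidable P) {e} → ¬ P e →
                       ∀ {l} → Walk (subdivide P?) (source e ↑ˡ m) (target e ↑ˡ m) l → suc s * 2 ≤ l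
    distance-removed P? {e} ¬Pe w = ≮⇒≥ λ l< → girth e (within-⊆
      (λ (i , Pi , j) → i , (λ { refl → ¬Pe Pi }) , j)
      (contract P? s w l< (splitAt-↑ˡ k (source e) m) (splitAt-↑ˡ k (target e) m)))

  Kept : Fin (2 ^ m) → Pred (Fin m) 0ℓ
  Kept j e = finToFun {2} {m} j e ≡ suc zero

  kept? : ∀ j → Decidable (Kept j)
  kept? j e = finToFun {2} {m} j e Fin.≟ suc zero

  family : TerminalFamily k
  order     family = k + m
  terminals family = prefix k m
  ∣K∣≡k     family = ∣prefix∣ k m
  size      family = 2 ^ m
  graph     family j = subdivide (kept? j)

  -- Suppose `e` is kept in graph `i` and removed in graph `j`, and the encodings agree. The common
  -- estimate for the ends of `e` is at most `upper 2` because of `i`, and at least a distance of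
  -- `suc s * 2` or more because of `j`. The hypothesis `gap` isolates what both kinds of error
  -- share.
  encode-injective : ∀ {s} → HighGirth s E → (D : DataStructure family) (upper : ℕ → ℝ) →
                     (∀ {d} → suc s * 2 ≤ d → upper 2 <ᴿ fromℕ d) → Estimates D upper →
                     Injective _≡_ _≡_ (encode D)
  encode-injective {s} girth D upper gap est {i} {j} eq = finToFun-injective {2} m same
    where
    separate : ∀ i j → encode D i ≡ encode D j → ∀ e → Kept i e → ¬ ¬ Kept j e
    separate i j eq e ke ¬ke = ¬¬-distance (graph family j) u v λ d δ →
      clash d δ (proj₁ (est j u v u∈ v∈ d δ))
        (subst (λ c → decode D c u v ≤⁺ [ upper 2 ]) eq
          (proj₂ (est i u v u∈ v∈ [ 2 ] (distance-kept girth (kept? i) ke))))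
      where
      u = source e ↑ˡ m
      v = target e ↑ˡ m
      u∈ = ↑ˡ∈prefix m (source e)
      v∈ = ↑ˡ∈prefix m (target e)
      clash : ∀ d → IsDistance (graph family j) u v d → ∀ {r : ℝ ⁺} →
              Maybe.map fromℕ d ≤⁺ r → r ≤⁺ [ upper 2 ] → ⊥
      clash [ d ] (w , _) {[ r ]} [ d≤r ] [ r≤ ] =
        ≤ᴿ∧≤ᴿ⇒≮ᴿ {fromℕ d} {r} {upper 2} d≤r r≤ (gap (distance-removed girth (kept? j) ¬ke w))
      -- Removing edges may disconnect the ends; the estimate is then infinite and exceeds the
      -- finite `upper 2`.
      clash ⊤⁺    _       (_ ≤⊤⁺) ()
    same : ∀ e → finToFun {2} {m} i e ≡ finToFun {2} {m} j e
    same e with finToFun {2} {m} i e in i≡ | finToFun {2} {m} j e in j≡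
    ... | zero     | zero     = refl
    ... | suc zero | suc zero = refl
    ... | suc zero | zero     = contradiction (λ k → case trans (sym j≡) k of λ ()) (separate i j eq e i≡)
    ... | zero     | suc zero = contradiction (λ k → case trans (sym i≡) k of λ ()) (separate j i (sym eq) e j≡)

-- Choice of parameters and the final bounds.

*-^-distrib : ∀ a b s → (a * b) ^ s ≡ a ^ s * b ^ s
*-^-distrib a b zero    = refl
*-^-distrib a b (suc s) = trans (cong (a * b *_) (*-^-distrib a b s))
  (solve 4 (λ a b x y → a :* b :* (x :* y) := a :* x :* (b :* y)) refl a b (a ^ s) (b ^ s))
  where open ℕ-Solver

module Parameters (s : ℕ) (i : ℕ) where

  -- The exponent `suc s` stands for t - 1. Taking `Δ` even makes the number of edges exactly
  -- `B * D`, and `D` positive gives `suc Δ ≤ 3 * D`.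
  D Δ B : ℕ
  D = suc i
  Δ = D * 2
  B = suc Δ ^ suc s

  open Greedy {B + B} (suc s) Δ B refl ≤-refl using (Good; greedy)

  construction : ∃[ E ] length E ≡ B * D × Good E
  construction = greedy (B * D) (≤-reflexive (*-assoc B D 2))

  edges : Edges
  edges = proj₁ construction

  length-edges : length edges ≡ B * D
  length-edges = proj₁ (proj₂ construction)

  girth : HighGirth (suc s) edges
  girth = proj₂ (proj₂ (proj₂ construction))

  open Subdivision edges public using (family; encode-injective)

  -- One factor `k = B + B` is at most the `suc s`-th power of `2 * suc Δ`, so the left side is at
  -- most that power of `4 * B * suc Δ`. With `suc Δ ≤ 3 * D` this gives the constant 12.
  dense : ∀ {L} → B * D ≤ L → AtLeastPower 12 (suc s) (B + B) L
  dense {L} BD≤L = begin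
    (B + B) * (B + B) ^ suc s                ≤⟨ *-monoˡ-≤ ((B + B) ^ suc s) B+B≤ ⟩
    (2 * suc Δ) ^ suc s * (B + B) ^ suc s    ≡⟨ *-^-distrib (2 * suc Δ) (B + B) (suc s) ⟨
    (2 * suc Δ * (B + B)) ^ suc s            ≤⟨ ^-monoˡ-≤ (suc s) base≤ ⟩
    (12 * L) ^ suc s                         ∎
    where
    open ≤-Reasoning
    B+B≤ : B + B ≤ (2 * suc Δ) ^ suc s
    B+B≤ = begin
      B + B                      ≡⟨ cong (B +_) (+-identityʳ B) ⟨
      2 * B                      ≤⟨ *-monoˡ-≤ B (^-monoʳ-≤ 2 {1} {suc s} (s≤s z≤n)) ⟩
      2 ^ suc s * suc Δ ^ suc s  ≡⟨ *-^-distrib 2 (suc Δ) (suc s) ⟨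
      (2 * suc Δ) ^ suc s        ∎
    rearrange : ∀ i B → 2 * suc (suc i * 2) * (B + B) + 4 * B * i ≡ 12 * (B * suc i)
    rearrange = solve 2 (λ i B →
      con 2 :* (con 1 :+ (con 1 :+ i) :* con 2) :* (B :+ B) :+ con 4 :* B :* i
        := con 12 :* (B :* (con 1 :+ i))) refl
      where open ℕ-Solver
    base≤ : 2 * suc Δ * (B + B) ≤ 12 * L
    base≤ = begin
      2 * suc Δ * (B + B)                    ≤⟨ m≤m+n _ (4 * B * i) ⟩
      2 * suc Δ * (B + B) + 4 * B * i        ≡⟨ rearrange i B ⟩
      12 * (B * D)                           ≤⟨ *-monoʳ-≤ 12 BD≤L ⟩
      12 * L                                 ∎

  -- The midpoints alone suffice: there are `B * D` of them against `B + B` terminals, and the ratio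
  -- `D / 2` grows with `i`.
  order-superlinear : ∀ M → M + M ≤ i → M * (B + B) ≤ order family
  order-superlinear M 2M≤i = begin
    M * (B + B)           ≡⟨ swap-sums M B ⟩
    B * (M + M)           ≤⟨ *-monoʳ-≤ B (≤-trans 2M≤i (n≤1+n i)) ⟩
    B * D                 ≡⟨ length-edges ⟨
    length edges          ≤⟨ m≤n+m (length edges) (B + B) ⟩
    B + B + length edges  ∎
    where
    open ≤-Reasoning
    swap-sums : ∀ M B → M * (B + B) ≡ B * (M + M)
    swap-sums = solve 2 (λ M B → M :* (B :+ B) := B :* (M :+ M)) refl
      where open ℕ-Solver

  long-encoding : (D : DataStructure family) → Injective _≡_ _≡_ (encode D) →
                  ∃[ j ] AtLeastPower 12 (suc s) (B + B) (bits D j)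
  long-encoding D inj =
    let j , m≤ = injective⇒long (length edges) (encode D) inj ≤-refl
    in j , dense (subst (_≤ bits D j) length-edges m≤)

theorem1p5 : (t : ℕ) → 2 ≤ t → (ε : ℝ) → 0ᴿ <ᴿ ε →
    Σ[ k ∈ (ℕ → ℕ) ] (∀ i j → i < j → k i < k j) ×
    (Σ[ F ∈ (∀ i → TerminalFamily (k i)) ]
    LittleO k (λ i → order (F i)) ×
    (∃[ C ] (∀ i j → edgeCount (graph (F i) j) ≤ C * order (F i))) ×
    (∃[ b ] 0 < b ×
    (∀ i (D : DataStructure (F i)) →
    MultiplicativeError D (fromℕ t -ᴿ ε) ⊎ AdditiveError D (2 * t ∸ 3) →
    ∃[ j ] AtLeastPower b (t ∸ 1) (k i) (bits D j))))
theorem1p5 (suc zero) (s≤s ())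
theorem1p5 t@(suc (suc r)) 2≤t ε 0<ε =
  (λ i → B i + B i) , increasing , family ,
  (λ M → M + M , λ i → order-superlinear i M) ,
  (4 , λ i j → Subdivision.edgeCount-subdivide (edges i) (Subdivision.kept? (edges i) j)) ,
  12 , s≤s z≤n , λ i D → λ where
    (inj₁ mult) → long-encoding i D (encode-injective i (girth i) D
                    (λ d → d ·ᴿ (fromℕ t -ᴿ ε)) (2·[t-ε]<2t {t} {ε} 0<ε) mult)
    (inj₂ add)  → long-encoding i D (encode-injective i (girth i) D
                    (λ d → fromℕ (d + (2 * t ∸ 3))) (λ le → fromℕ-mono-< (≤-trans (≤-reflexive additive) le)) add)
  where
  -- As `t` is `r + 2`, the girth parameter `suc r` is t - 1, and removed edges have their ends at
  -- distance at least `t * 2`.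
  open module P = Parameters r
  increasing : ∀ i j → i < j → B i + B i < B j + B j
  increasing i j i<j = +-mono-< B< B<
    where
    B< : B i < B j
    B< = ^-monoˡ-< (suc r) (s≤s (*-monoˡ-< 2 (s≤s i<j)))
  -- The additive bound at distance 2 is 2t - 1, one short of `t * 2`; the truncated subtraction is
  -- exact because 2t is at least 4.
  additive : suc (2 + (2 * t ∸ 3)) ≡ t * 2
  additive = trans (m+[n∸m]≡n {3} (≤-trans (s≤s (s≤s (s≤s z≤n))) (*-monoʳ-≤ 2 2≤t))) (*-comm 2 t)
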